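{- The variety $\mathcal{V}$ of all lattices (in the signature $\{\wedge,\vee\}$) is not coherent, does not admit right uniform deductive interpolation, and its first-order theory does not have a model completion.
   Context: A variety $\mathcal{V}$ is coherent if every finitely generated subalgebra of a finitely presented member of $\mathcal{V}$ is finitely presented (finitely presented: isomorphic to a quotient of a finitely generated free algebra of $\mathcal{V}$ by a finitely generated congruence). $\Sigma\models_{\mathcal{V}}\varepsilon$ means that every assignment of the variables into any member of $\mathcal{V}$ satisfying all equations in $\Sigma$ satisfies $\varepsilon$. $\mathcal{V}$ admits right uniform deductive interpolation if for any finite disjoint sets of variables $\overline{x},\overline{y}$ (with $\overline{y}$ nonempty, as the signature has no constants) and finite set $\Sigma$ of equations in variables $\overline{x},\overline{y}$, there is a finite set $\Pi$ of equations in variables $\overline{y}$ such that for every equation $\varepsilon$ whose variables lie in $\overline{y}$ and a set $\overline{z}$ disjoint from $\overline{x},\overline{y}$: $\Sigma\models_{\mathcal{V}}\varepsilon\iff\Pi\models_{\mathcal{V}}\varepsilon$. A model completion of a theory $T$ is a theory $T^*\supseteq T$ in the same language such that every model of $T$ embeds into a model of $T^*$ and, for every model $M$ of $T$, $T^*$ together with the quantifier-free diagram of $M$ is a complete theory. -}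

module Defs where

open import Level using (Level; 0ℓ) renaming (suc to lsuc)
open import Algebra.Lattice.Bundles using (Lattice; RawLattice)
open import Algebra.Lattice.Morphism.Structures using (IsLatticeIsomorphism; IsLatticeMonomorphism)
open import Data.Empty using (⊥)
open import Data.Fin.Base using (Fin; zero; suc)
open import Data.List.Base using (List; []; _∷_; map)
open import Data.List.Membership.Propositional using (_∈_)
open import Data.List.Relation.Unary.All using (All)
open import Data.Nat.Base using (ℕ; zero; suc)
open import Data.Product using (Σ; Σ-syntax; ∃; ∃-syntax; _×_; _,_; proj₁; proj₂)
import Data.Product as Product
open import Data.Sum.Base using (_⊎_; inj₁; inj₂; [_,_])
import Data.Sum.Base as Sum
import Data.Vec.Functional as Vector
open import Function.Base using (_∘_)
open import Function.Bundles using (_⇔_)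
open import Relation.Binary.PropositionalEquality using (_≡_)
open import Relation.Binary.Structures using (IsEquivalence)
open import Relation.Nullary.Negation using (¬_)
open import Relation.Unary using (Pred; _∪_; _⊆_)

-- Algebras are setoid-based and live in Set.  Since the signature has no
-- constants, algebras are taken to be nonempty: generating sets below have
-- size suc n, and first-order structures carry a point.

infixr 7 _⊓_
infixr 6 _⊔_

data Term (X : Set) : Set where
  var : X → Term X
  _⊓_ : Term X → Term X → Term X
  _⊔_ : Term X → Term X → Term X

bind : ∀ {X Y : Set} → (X → Term Y) → Term X → Term Y
bind σ (var x) = σ x
bind σ (s ⊓ t) = bind σ s ⊓ bind σ t
bind σ (s ⊔ t) = bind σ s ⊔ bind σ t

rename : ∀ {X Y : Set} → (X → Y) → Term X → Term Y
rename f = bind (var ∘ f)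

Equation : Set → Set
Equation X = Term X × Term X

renameEq : ∀ {X Y : Set} → (X → Y) → Equation X → Equation Y
renameEq f = Product.map (rename f) (rename f)

module _ (A : RawLattice 0ℓ 0ℓ) where
  open RawLattice A

  eval : ∀ {X : Set} → (X → Carrier) → Term X → Carrier
  eval ρ (var x) = ρ x
  eval ρ (s ⊓ t) = eval ρ s ∧ eval ρ t
  eval ρ (s ⊔ t) = eval ρ s ∨ eval ρ t

  Satisfies : ∀ {X : Set} → (X → Carrier) → Equation X → Set
  Satisfies ρ (s , t) = eval ρ s ≈ eval ρ t

infix 4 _≅_

_≅_ : Lattice 0ℓ 0ℓ → Lattice 0ℓ 0ℓ → Set
A ≅ B = ∃[ f ] IsLatticeIsomorphism (Lattice.rawLattice A) (Lattice.rawLattice B) f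

data _∼_ {X : Set} : Term X → Term X → Set where
  ∼-refl  : ∀ {s} → s ∼ s
  ∼-sym   : ∀ {s t} → s ∼ t → t ∼ s
  ∼-trans : ∀ {s t u} → s ∼ t → t ∼ u → s ∼ u
  ⊓-cong  : ∀ {s s′ t t′} → s ∼ s′ → t ∼ t′ → s ⊓ t ∼ s′ ⊓ t′
  ⊔-cong  : ∀ {s s′ t t′} → s ∼ s′ → t ∼ t′ → s ⊔ t ∼ s′ ⊔ t′
  ⊓-comm  : ∀ s t → s ⊓ t ∼ t ⊓ s
  ⊔-comm  : ∀ s t → s ⊔ t ∼ t ⊔ s
  ⊓-assoc : ∀ s t u → (s ⊓ t) ⊓ u ∼ s ⊓ (t ⊓ u)
  ⊔-assoc : ∀ s t u → (s ⊔ t) ⊔ u ∼ s ⊔ (t ⊔ u)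
  ⊓-absorbs-⊔ : ∀ s t → s ⊓ (s ⊔ t) ∼ s
  ⊔-absorbs-⊓ : ∀ s t → s ⊔ (s ⊓ t) ∼ s

infix 4 _∼_

FreeLattice : Set → Lattice 0ℓ 0ℓ
FreeLattice X = record
  { Carrier = Term X
  ; _≈_ = _∼_
  ; _∨_ = _⊔_
  ; _∧_ = _⊓_
  ; isLattice = record
    { isEquivalence = record { refl = ∼-refl ; sym = ∼-sym ; trans = ∼-trans }
    ; ∨-comm = ⊔-comm
    ; ∨-assoc = ⊔-assoc
    ; ∨-cong = ⊔-cong
    ; ∧-comm = ⊓-comm
    ; ∧-assoc = ⊓-assoc
    ; ∧-cong = ⊓-cong
    ; absorptive = ⊔-absorbs-⊓ , ⊓-absorbs-⊔
    }
  }

module _ (A : Lattice 0ℓ 0ℓ) where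
  open Lattice A

  data Cg (R : List (Carrier × Carrier)) : Carrier → Carrier → Set where
    generator : ∀ {a b} → (a , b) ∈ R → Cg R a b
    base : ∀ {a b} → a ≈ b → Cg R a b
    Cg-sym : ∀ {a b} → Cg R a b → Cg R b a
    Cg-trans : ∀ {a b c} → Cg R a b → Cg R b c → Cg R a c
    ∧-compatible : ∀ {a a′ b b′} → Cg R a a′ → Cg R b b′ → Cg R (a ∧ b) (a′ ∧ b′)
    ∨-compatible : ∀ {a a′ b b′} → Cg R a a′ → Cg R b b′ → Cg R (a ∨ b) (a′ ∨ b′)

  Quotient : List (Carrier × Carrier) → Lattice 0ℓ 0ℓ
  Quotient R = record
    { Carrier = Carrier
    ; _≈_ = Cg R
    ; _∨_ = _∨_
    ; _∧_ = _∧_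
    ; isLattice = record
      { isEquivalence = record
        { refl = base refl ; sym = Cg-sym ; trans = Cg-trans }
      ; ∨-comm = λ a b → base (∨-comm a b)
      ; ∨-assoc = λ a b c → base (∨-assoc a b c)
      ; ∨-cong = ∨-compatible
      ; ∧-comm = λ a b → base (∧-comm a b)
      ; ∧-assoc = λ a b c → base (∧-assoc a b c)
      ; ∧-cong = ∧-compatible
      ; absorptive = (λ a b → base (∨-absorbs-∧ a b))
                   , (λ a b → base (∧-absorbs-∨ a b))
      }
    }

  data Generated {k : ℕ} (g : Fin k → Carrier) : Carrier → Set where
    generator : ∀ i → Generated g (g i)
    meet : ∀ {a b} → Generated g a → Generated g b → Generated g (a ∧ b)
    join : ∀ {a b} → Generated g a → Generated g b → Generated g (a ∨ b)
    respects : ∀ {a b} → a ≈ b → Generated g a → Generated g b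

  Subalgebra : ∀ {k} → (Fin k → Carrier) → Lattice 0ℓ 0ℓ
  Subalgebra g = record
    { Carrier = Σ[ a ∈ Carrier ] Generated g a
    ; _≈_ = λ a b → proj₁ a ≈ proj₁ b
    ; _∨_ = λ a b → proj₁ a ∨ proj₁ b , join (proj₂ a) (proj₂ b)
    ; _∧_ = λ a b → proj₁ a ∧ proj₁ b , meet (proj₂ a) (proj₂ b)
    ; isLattice = record
      { isEquivalence = record { refl = refl ; sym = sym ; trans = trans }
      ; ∨-comm = λ a b → ∨-comm (proj₁ a) (proj₁ b)
      ; ∨-assoc = λ a b c → ∨-assoc (proj₁ a) (proj₁ b) (proj₁ c)
      ; ∨-cong = ∨-cong
      ; ∧-comm = λ a b → ∧-comm (proj₁ a) (proj₁ b)
      ; ∧-assoc = λ a b c → ∧-assoc (proj₁ a) (proj₁ b) (proj₁ c)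
      ; ∧-cong = ∧-cong
      ; absorptive = (λ a b → ∨-absorbs-∧ (proj₁ a) (proj₁ b))
                   , (λ a b → ∧-absorbs-∨ (proj₁ a) (proj₁ b))
      }
    }

FinitelyPresented : Lattice 0ℓ 0ℓ → Set
FinitelyPresented A =
  ∃[ n ] Σ[ R ∈ List (Equation (Fin (suc n))) ] A ≅ Quotient (FreeLattice (Fin (suc n))) R

Coherent : Set₁
Coherent =
  ∀ (A : Lattice 0ℓ 0ℓ) → FinitelyPresented A →
  ∀ {k} (g : Fin (suc k) → Lattice.Carrier A) → FinitelyPresented (Subalgebra A g)

infix 4 _⊨ᵥ_

_⊨ᵥ_ : ∀ {X : Set} → List (Equation X) → Equation X → Set₁
_⊨ᵥ_ {X} Γ ε =
  ∀ (A : Lattice 0ℓ 0ℓ) (ρ : X → Lattice.Carrier A) →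
  All (Satisfies (Lattice.rawLattice A) ρ) Γ → Satisfies (Lattice.rawLattice A) ρ ε

-- The disjoint variable sets x̄, ȳ, z̄ are the summands of
-- Fin m ⊎ (Fin (suc n) ⊎ Fin k); ε is an equation in ȳ and z̄.
RightUniformDeductiveInterpolation : Set₁
RightUniformDeductiveInterpolation =
  ∀ m n (Γ : List (Equation (Fin m ⊎ Fin (suc n)))) →
  Σ[ Π ∈ List (Equation (Fin (suc n))) ]
    (∀ k (ε : Equation (Fin (suc n) ⊎ Fin k)) →
      (map (renameEq (Sum.map₂ inj₁)) Γ ⊨ᵥ renameEq (inj₂ {A = Fin m}) ε)
      ⇔
      (map (renameEq (inj₂ ∘ inj₁)) Π ⊨ᵥ renameEq (inj₂ {A = Fin m}) ε))

infix  8 _≐_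
infixr 5 _⇒_

-- Formulas with constants from C and free de Bruijn variables from Fin n;
-- the remaining connectives are the usual classical abbreviations.
data Formula (C : Set) (n : ℕ) : Set where
  falsum : Formula C n
  _≐_ : Term (C ⊎ Fin n) → Term (C ⊎ Fin n) → Formula C n
  _⇒_ : Formula C n → Formula C n → Formula C n
  all : Formula C (suc n) → Formula C n

neg : ∀ {C n} → Formula C n → Formula C n
neg φ = φ ⇒ falsum

data QuantifierFree {C : Set} {n : ℕ} : Formula C n → Set where
  falsum : QuantifierFree falsum
  _≐_ : ∀ s t → QuantifierFree (s ≐ t)
  _⇒_ : ∀ {φ ψ} → QuantifierFree φ → QuantifierFree ψ → QuantifierFree (φ ⇒ ψ)

SentenceOver : Set → Set
SentenceOver C = Formula C zero

Sentence : Set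
Sentence = SentenceOver ⊥

Theory : Set₂
Theory = Pred Sentence (lsuc 0ℓ)

mapConst : ∀ {C D : Set} {n} → (C → D) → Formula C n → Formula D n
mapConst f falsum = falsum
mapConst f (s ≐ t) = rename (Sum.map₁ f) s ≐ rename (Sum.map₁ f) t
mapConst f (φ ⇒ ψ) = mapConst f φ ⇒ mapConst f ψ
mapConst f (all φ) = all (mapConst f φ)

-- Substitutions leave constants fixed.
Subst : Set → ℕ → ℕ → Set
Subst C n m = Fin n → Term (C ⊎ Fin m)

substTerm : ∀ {C n m} → Subst C n m → Term (C ⊎ Fin n) → Term (C ⊎ Fin m)
substTerm σ = bind [ var ∘ inj₁ , σ ]

lift : ∀ {C n m} → Subst C n m → Subst C (suc n) (suc m)
lift σ zero = var (inj₂ zero)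
lift σ (suc i) = rename (Sum.map₂ suc) (σ i)

subst : ∀ {C n m} → Subst C n m → Formula C n → Formula C m
subst σ falsum = falsum
subst σ (s ≐ t) = substTerm σ s ≐ substTerm σ t
subst σ (φ ⇒ ψ) = subst σ φ ⇒ subst σ ψ
subst σ (all φ) = all (subst (lift σ) φ)

weaken : ∀ {C n} → Formula C n → Formula C (suc n)
weaken = subst (var ∘ inj₂ ∘ suc)

_[_] : ∀ {C n} → Formula C (suc n) → Term (C ⊎ Fin n) → Formula C n
φ [ t ] = subst (λ { zero → t ; (suc i) → var (inj₂ i) }) φ

-- Classical natural deduction from the axioms T and the local hypotheses Δ.
-- At n = 0 there are closed terms to instantiate quantifiers with only if C is
-- inhabited; the calculus is applied below only with C the carrier of a
-- (nonempty) structure.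
data Derivation {C : Set} {ℓ : Level} (T : Pred (SentenceOver C) ℓ) :
       {n : ℕ} → List (Formula C n) → Formula C n → Set ℓ where
  axiom : ∀ {n} {Δ : List (Formula C n)} {φ} → T φ → Derivation T Δ (subst (λ ()) φ)
  hypothesis : ∀ {n} {Δ : List (Formula C n)} {φ} → φ ∈ Δ → Derivation T Δ φ
  ⇒-intro : ∀ {n} {Δ : List (Formula C n)} {φ ψ} →
            Derivation T (φ ∷ Δ) ψ → Derivation T Δ (φ ⇒ ψ)
  ⇒-elim : ∀ {n} {Δ : List (Formula C n)} {φ ψ} →
           Derivation T Δ (φ ⇒ ψ) → Derivation T Δ φ → Derivation T Δ ψ
  by-contradiction : ∀ {n} {Δ : List (Formula C n)} {φ} →
                     Derivation T (neg φ ∷ Δ) falsum → Derivation T Δ φ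
  all-intro : ∀ {n} {Δ : List (Formula C n)} {φ} →
              Derivation T (map weaken Δ) φ → Derivation T Δ (all φ)
  all-elim : ∀ {n} {Δ : List (Formula C n)} {φ} →
             Derivation T Δ (all φ) → ∀ t → Derivation T Δ (φ [ t ])
  ≐-refl : ∀ {n} {Δ : List (Formula C n)} t → Derivation T Δ (t ≐ t)
  ≐-subst : ∀ {n} {Δ : List (Formula C n)} {s t} (φ : Formula C (suc n)) →
            Derivation T Δ (s ≐ t) → Derivation T Δ (φ [ s ]) → Derivation T Δ (φ [ t ])

infix 4 _⊢_

_⊢_ : ∀ {C : Set} {ℓ} → Pred (SentenceOver C) ℓ → SentenceOver C → Set ℓ
T ⊢ φ = Derivation T [] φ

-- Double negation makes the disjunction classical.
Complete : ∀ {C : Set} {ℓ} → Pred (SentenceOver C) ℓ → Set ℓ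
Complete T = ¬ (T ⊢ falsum) × (∀ φ → ¬ ¬ (T ⊢ φ ⊎ T ⊢ neg φ))

record Structure : Set₁ where
  field
    rawLattice : RawLattice 0ℓ 0ℓ
  open RawLattice rawLattice public
  field
    isEquivalence : IsEquivalence _≈_
    ∧-cong : ∀ {a a′ b b′} → a ≈ a′ → b ≈ b′ → a ∧ b ≈ a′ ∧ b′
    ∨-cong : ∀ {a a′ b b′} → a ≈ a′ → b ≈ b′ → a ∨ b ≈ a′ ∨ b′
    point : Carrier

module _ (M : Structure) where
  open Structure M

  -- Tarskian truth in its classical reading: the double negation on atoms makes
  -- truth of every formula stable under double negation, so that classical deduction is sound.
  truth : ∀ {C : Set} {n} → (C → Carrier) → (Fin n → Carrier) → Formula C n → Set
  truth c ρ falsum = ⊥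
  truth c ρ (s ≐ t) = ¬ ¬ (eval rawLattice [ c , ρ ] s ≈ eval rawLattice [ c , ρ ] t)
  truth c ρ (φ ⇒ ψ) = truth c ρ φ → truth c ρ ψ
  truth c ρ (all φ) = ∀ a → truth c (a Vector.∷ ρ) φ

infix 4 _⊨_ _⊨ₜ_

_⊨_ : Structure → Sentence → Set
M ⊨ φ = truth M (λ ()) (λ ()) φ

_⊨ₜ_ : Structure → Theory → Set₁
M ⊨ₜ T = ∀ {φ} → T φ → M ⊨ φ

Embeds : Structure → Structure → Set
Embeds M N = ∃[ f ] IsLatticeMonomorphism (Structure.rawLattice M) (Structure.rawLattice N) f

-- Each element of M is a constant naming itself.
Diagram : ∀ M → Pred (SentenceOver (Structure.Carrier M)) 0ℓ
Diagram M φ = QuantifierFree φ × truth M (λ a → a) (λ ()) φ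

-- T regarded as a set of sentences in the language with constants C.
withConstants : ∀ C → Theory → Pred (SentenceOver C) (lsuc 0ℓ)
withConstants C T φ = ∃[ ψ ] T ψ × φ ≡ mapConst (λ ()) ψ

record IsModelCompletion (T T* : Theory) : Set₁ where
  field
    extends : T ⊆ T*
    embeds : ∀ M → M ⊨ₜ T → ∃[ N ] N ⊨ₜ T* × Embeds M N
    complete : ∀ M → M ⊨ₜ T → Complete (withConstants (Structure.Carrier M) T* ∪ Diagram M)

HasModelCompletion : Theory → Set₂
HasModelCompletion T = ∃[ T* ] IsModelCompletion T T*

toStructure : (A : Lattice 0ℓ 0ℓ) → Lattice.Carrier A → Structure
toStructure A a = record
  { rawLattice = rawLattice
  ; isEquivalence = isEquivalence
  ; ∧-cong = ∧-cong
  ; ∨-cong = ∨-cong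
  ; point = a
  }
  where open Lattice A

-- The set of all sentences true in every nonempty lattice.
LatticeTheory : Theory
LatticeTheory φ = ∀ (A : Lattice 0ℓ 0ℓ) (a : Lattice.Carrier A) → toStructure A a ⊨ φ

{-# OPTIONS --safe #-}
module Submission where

-- Let t(x) = d ∧ (a ∨ (b ∧ (c ∨ x))), and let Γ say that e ≤ x ≤ t(x).  Since t is monotone and
-- t(x) ≤ d, Γ implies e ≤ tⁿ(d) for every n.  Conversely, if e ≤ tⁿ(d) holds for all n in a
-- lattice L, then Γ has a solution in an extension of L, namely the formal infimum of the tⁿ(d)
-- in the completion of L by filters.  Hence the equations in a, b, c, d, e that follow from Γ are
-- axiomatised by the bounds e ≤ tⁿ(d), and no finite set suffices: it would follow from finitely
-- many bounds, hence from a single one, but e ≤ tⁿ(d) does not imply e ≤ tⁿ⁺¹(d).  A right uniform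
-- interpolant for Γ, a finite presentation of the sublattice generated by a, b, c, d, e in the
-- lattice presented by Γ, and a proof of ∃x Γ from a model completion and the diagram of the
-- lattice presented by all the bounds would each provide such a finite set.

open import Defs
open import Level using (Level; 0ℓ) renaming (suc to lsuc)
open import Algebra.Lattice.Bundles using (Lattice; RawLattice)
open import Algebra.Lattice.Morphism.Structures using (IsLatticeHomomorphism; IsLatticeIsomorphism; IsLatticeMonomorphism)
open import Algebra.Lattice.Morphism.Construct.Composition using (isLatticeMonomorphism)
import Algebra.Lattice.Morphism.Construct.Identity as Identity
import Algebra.Lattice.Properties.Lattice as LatticeProperties
open import Data.Empty using (⊥; ⊥-elim)
open import Data.Fin.Base using (Fin; zero; suc)
open import Data.Fin.Patterns using (0F; 1F; 2F; 3F; 4F)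
open import Data.List.Base as List using (List; []; _∷_; _++_; map)
open import Data.List.Relation.Unary.All as All using (All; []; _∷_)
import Data.List.Relation.Unary.All.Properties as All
open import Data.List.Relation.Unary.Any using (here; there)
open import Data.Nat.Base using (ℕ; zero; suc; pred; _≤_; z≤n)
import Data.Nat.Base as ℕ
import Data.Nat.Properties as ℕ
open import Data.Product using (Σ-syntax; ∃-syntax; _×_; _,_; proj₁; proj₂; uncurry)
open import Data.Sum.Base using (_⊎_; inj₁; inj₂; [_,_])
import Data.Sum.Base as Sum
import Data.Vec.Functional as Vector
open import Function.Base using (_∘_; id)
open import Function.Bundles using (_⇔_; mk⇔; module Equivalence)
import Function.Properties.Equivalence as ⇔
open import Function.Related.TypeIsomorphisms using (→-cong-⇔; ¬-cong-⇔)
open import Relation.Binary.Construct.Interior.Symmetric using (isPartialOrder; _,_)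
open import Relation.Binary.Core using (Rel)
open import Relation.Binary.Definitions using (Transitive)
import Relation.Binary.Lattice as Order
open import Relation.Binary.Lattice.Definitions using (Supremum; Infimum)
import Relation.Binary.Lattice.Properties.JoinSemilattice as JoinProperties
import Relation.Binary.Lattice.Properties.Lattice as OrderLatticeProperties
import Relation.Binary.Lattice.Properties.MeetSemilattice as MeetProperties
open import Relation.Binary.Structures using (IsEquivalence)
open import Relation.Binary.PropositionalEquality using (_≡_; refl; sym; trans; cong; cong₂)
  renaming (subst to ≡-subst)
open import Relation.Nullary.Negation using (¬_; ¬¬-map; contradiction; negated-stable)
open import Relation.Unary using (Pred; _∪_)

open Equivalence using (to; from)

-- Terms and lattices

infix 4 _≼_

-- The natural order of a lattice in the library is x ≈ x ∧ y.
_≼_ : ∀ {X : Set} → Term X → Term X → Equation X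
s ≼ t = s , s ⊓ t

Sat : ∀ (A : Lattice 0ℓ 0ℓ) {X : Set} → (X → Lattice.Carrier A) → Equation X → Set
Sat A = Satisfies (Lattice.rawLattice A)

module LatticeOrder (A : Lattice 0ℓ 0ℓ) where
  orderLattice : Order.Lattice 0ℓ 0ℓ 0ℓ
  orderLattice = LatticeProperties.∨-∧-orderTheoreticLattice A

  open Order.Lattice orderLattice public
  open JoinProperties joinSemilattice public using (∨-monotonic)
  open MeetProperties meetSemilattice public using (∧-monotonic)

-- Lattices carry a setoid equality, so a preorder with binary suprema and infima becomes a lattice
-- once equality means `≲` in both directions.
module FromPreorder {C : Set} {_≲_ : Rel C 0ℓ} {_∨_ _∧_ : C → C → C}
                    (≲-refl : ∀ s → s ≲ s) (≲-trans : ∀ s t u → s ≲ t → t ≲ u → s ≲ u)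
                    (sup : Supremum _≲_ _∨_) (inf : Infimum _≲_ _∧_) where

  lattice : Lattice 0ℓ 0ℓ
  lattice = OrderLatticeProperties.algLattice record
    { isLattice = record
      { isPartialOrder = isPartialOrder (λ {s} → ≲-refl s) (λ {s} {t} {u} → ≲-trans s t u)
      ; supremum = sup
      ; infimum = inf
      }
    }

  ≲⇒≤ : ∀ {s t} → s ≲ t → LatticeOrder._≤_ lattice s t
  ≲⇒≤ {s} {t} s≲t = let s∧t≲s , _ , greatest = inf s t in greatest s (≲-refl s) s≲t , s∧t≲s

  ≤⇒≲ : ∀ {s t} → LatticeOrder._≤_ lattice s t → s ≲ t
  ≤⇒≲ {s} {t} (s≲s∧t , _) = let _ , s∧t≲t , _ = inf s t in ≲-trans s _ t s≲s∧t s∧t≲t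

eval-bind : ∀ (A : RawLattice 0ℓ 0ℓ) {X Y : Set} {ρ : Y → RawLattice.Carrier A} (σ : X → Term Y) s →
            eval A ρ (bind σ s) ≡ eval A (eval A ρ ∘ σ) s
eval-bind A σ (var x) = refl
eval-bind A σ (s ⊓ t) = cong₂ (RawLattice._∧_ A) (eval-bind A σ s) (eval-bind A σ t)
eval-bind A σ (s ⊔ t) = cong₂ (RawLattice._∨_ A) (eval-bind A σ s) (eval-bind A σ t)

bind-var : ∀ {X : Set} (s : Term X) → bind var s ≡ s
bind-var (var x) = refl
bind-var (s ⊓ t) = cong₂ _⊓_ (bind-var s) (bind-var t)
bind-var (s ⊔ t) = cong₂ _⊔_ (bind-var s) (bind-var t)

satisfies-bind : ∀ (A : RawLattice 0ℓ 0ℓ) {X Y : Set} {ρ : Y → RawLattice.Carrier A} (σ : X → Term Y) s t →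
                 Satisfies A ρ (bind σ s , bind σ t) ⇔ Satisfies A (eval A ρ ∘ σ) (s , t)
satisfies-bind A {ρ = ρ} σ s t rewrite eval-bind A {ρ = ρ} σ s | eval-bind A {ρ = ρ} σ t = mk⇔ id id

module _ (A : Structure) where
  open Structure A
  private module ≈ = IsEquivalence isEquivalence

  -- Stated for structures, so as to cover models of first-order theories as well as lattices.
  eval-cong : ∀ {X : Set} {ρ ρ′ : X → Carrier} →
              (∀ x → ρ x ≈ ρ′ x) → ∀ s → eval rawLattice ρ s ≈ eval rawLattice ρ′ s
  eval-cong ρ≈ρ′ (var x) = ρ≈ρ′ x
  eval-cong ρ≈ρ′ (s ⊓ t) = ∧-cong (eval-cong ρ≈ρ′ s) (eval-cong ρ≈ρ′ t)
  eval-cong ρ≈ρ′ (s ⊔ t) = ∨-cong (eval-cong ρ≈ρ′ s) (eval-cong ρ≈ρ′ t)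

  satisfies-cong : ∀ {X : Set} {ρ ρ′ : X → Carrier} → (∀ x → ρ x ≈ ρ′ x) →
                   ∀ ε → Satisfies rawLattice ρ ε ⇔ Satisfies rawLattice ρ′ ε
  satisfies-cong ρ≈ρ′ (s , t) = mk⇔
    (λ eq → ≈.trans (≈.sym (eval-cong ρ≈ρ′ s)) (≈.trans eq (eval-cong ρ≈ρ′ t)))
    (λ eq → ≈.trans (eval-cong ρ≈ρ′ s) (≈.trans eq (≈.sym (eval-cong ρ≈ρ′ t))))

module _ {A : RawLattice 0ℓ 0ℓ} (B : Structure)
         {h : RawLattice.Carrier A → Structure.Carrier B}
         (hom : IsLatticeHomomorphism A (Structure.rawLattice B) h) where
  open Structure B
  open IsLatticeHomomorphism hom
  private module ≈ = IsEquivalence isEquivalence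

  eval-homo : ∀ {X : Set} {ρ : X → RawLattice.Carrier A} s →
              eval rawLattice (h ∘ ρ) s ≈ h (eval A ρ s)
  eval-homo (var x) = ≈.refl
  eval-homo (s ⊓ t) = ≈.trans (∧-cong (eval-homo s) (eval-homo t)) (≈.sym (∧-homo _ _))
  eval-homo (s ⊔ t) = ≈.trans (∨-cong (eval-homo s) (eval-homo t)) (≈.sym (∨-homo _ _))

  satisfies-homo : ∀ {X : Set} {ρ : X → RawLattice.Carrier A} ε →
                   Satisfies A ρ ε → Satisfies rawLattice (h ∘ ρ) ε
  satisfies-homo (s , t) eq =
    ≈.trans (eval-homo s) (≈.trans (⟦⟧-cong eq) (≈.sym (eval-homo t)))

module _ {A : RawLattice 0ℓ 0ℓ} (B : Structure)
         {h : RawLattice.Carrier A → Structure.Carrier B}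
         (mono : IsLatticeMonomorphism A (Structure.rawLattice B) h) where
  open Structure B
  open IsLatticeMonomorphism mono
  private module ≈ = IsEquivalence isEquivalence

  satisfies-reflect : ∀ {X : Set} {ρ : X → RawLattice.Carrier A} ε →
                      Satisfies rawLattice (h ∘ ρ) ε → Satisfies A ρ ε
  satisfies-reflect (s , t) eq = injective
    (≈.trans (≈.sym (eval-homo B isLatticeHomomorphism s))
      (≈.trans eq (eval-homo B isLatticeHomomorphism t)))

module _ (A : Lattice 0ℓ 0ℓ) where
  open Lattice A using (Carrier; _≈_; rawLattice)
  private module A = Lattice A

  -- The point of the structure is the value of one of the two terms.
  sat-cong : ∀ {X : Set} {ρ ρ′ : X → Carrier} → (∀ x → ρ x ≈ ρ′ x) → ∀ ε → Sat A ρ ε → Sat A ρ′ ε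
  sat-cong {ρ = ρ} ρ≈ρ′ (s , t) = to (satisfies-cong (toStructure A (eval rawLattice ρ s)) ρ≈ρ′ (s , t))

  ∼-elim : ∀ {X : Set} {ρ : X → Carrier} {s t} → s ∼ t → Sat A ρ (s , t)
  ∼-elim ∼-refl = A.refl
  ∼-elim (∼-sym p) = A.sym (∼-elim p)
  ∼-elim (∼-trans p q) = A.trans (∼-elim p) (∼-elim q)
  ∼-elim (⊓-cong p q) = A.∧-cong (∼-elim p) (∼-elim q)
  ∼-elim (⊔-cong p q) = A.∨-cong (∼-elim p) (∼-elim q)
  ∼-elim (⊓-comm s t) = A.∧-comm _ _
  ∼-elim (⊔-comm s t) = A.∨-comm _ _
  ∼-elim (⊓-assoc s t u) = A.∧-assoc _ _ _
  ∼-elim (⊔-assoc s t u) = A.∨-assoc _ _ _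
  ∼-elim (⊓-absorbs-⊔ s t) = A.∧-absorbs-∨ _ _
  ∼-elim (⊔-absorbs-⊓ s t) = A.∨-absorbs-∧ _ _

  -- The universal property of a presentation: the kernel of evaluation at `ρ` is a congruence
  -- containing `R`, hence contains the one that `R` generates.
  Cg-elim : ∀ {X : Set} {ρ : X → Carrier} {R} → All (Sat A ρ) R →
            ∀ {s t} → Cg (FreeLattice X) R s t → Sat A ρ (s , t)
  Cg-elim sat (generator st∈R) = All.lookup sat st∈R
  Cg-elim sat (base p) = ∼-elim p
  Cg-elim sat (Cg-sym p) = A.sym (Cg-elim sat p)
  Cg-elim sat (Cg-trans p q) = A.trans (Cg-elim sat p) (Cg-elim sat q)
  Cg-elim sat (∧-compatible p q) = A.∧-cong (Cg-elim sat p) (Cg-elim sat q)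
  Cg-elim sat (∨-compatible p q) = A.∨-cong (Cg-elim sat p) (Cg-elim sat q)

-- The system e ≤ x ≤ t(x)

-- The parameters d, a, b, c, e are y 0F, y 1F, y 2F, y 3F, y 4F in this order.
step : ∀ {X : Set} → (Fin 5 → X) → Term X → Term X
step y s = var (y 0F) ⊓ (var (y 1F) ⊔ (var (y 2F) ⊓ (var (y 3F) ⊔ s)))

lower upper : ∀ {X : Set} → X → (Fin 5 → X) → Equation X
lower x y = var (y 4F) ≼ var x
upper x y = var x ≼ step y (var x)

system : ∀ {X : Set} → X → (Fin 5 → X) → List (Equation X)
system x y = lower x y ∷ upper x y ∷ []

iter : ℕ → Term (Fin 5)
iter zero = var 0F
iter (suc n) = step id (iter n)

bound : ℕ → Equation (Fin 5)
bound n = var 4F ≼ iter n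

module _ (A : Lattice 0ℓ 0ℓ) (ρ : Fin 5 → Lattice.Carrier A) where
  open LatticeOrder A hiding (refl; trans; _≤_)
  private
    rawA = Lattice.rawLattice A
    module ≤ = LatticeOrder A

  stepValue : Carrier → Carrier
  stepValue x = ρ 0F ∧ (ρ 1F ∨ (ρ 2F ∧ (ρ 3F ∨ x)))

  stepValue-mono : ∀ {x x′} → x ≤.≤ x′ → stepValue x ≤.≤ stepValue x′
  stepValue-mono x≤x′ =
    ∧-monotonic ≤.refl (∨-monotonic ≤.refl (∧-monotonic ≤.refl (∨-monotonic ≤.refl x≤x′)))

  -- The outermost operation of t is a meet with d, so t(d) ≤ d; monotonicity carries this to every
  -- n.
  iter-decreasing : ∀ n → eval rawA ρ (iter (suc n)) ≤.≤ eval rawA ρ (iter n)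
  iter-decreasing zero = x∧y≤x _ _
  iter-decreasing (suc n) = stepValue-mono (iter-decreasing n)

  fixpoint-below-iter : ∀ {x} → x ≤.≤ stepValue x → ∀ n → x ≤.≤ eval rawA ρ (iter n)
  fixpoint-below-iter x≤tx zero = ≤.trans x≤tx (x∧y≤x _ _)
  fixpoint-below-iter x≤tx (suc n) = ≤.trans x≤tx (stepValue-mono (fixpoint-below-iter x≤tx n))

  bound-suc : ∀ n → Sat A ρ (bound (suc n)) → Sat A ρ (bound n)
  bound-suc n p = ≤.trans p (iter-decreasing n)

  bound-antitone : ∀ {m n} → m ℕ.≤′ n → Sat A ρ (bound n) → Sat A ρ (bound m)
  bound-antitone ℕ.≤′-refl p = p
  bound-antitone (ℕ.≤′-step {n} m≤n) p = bound-antitone m≤n (bound-suc n p)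

system⇒bound : ∀ (A : Lattice 0ℓ 0ℓ) {X : Set} {ρ : X → Lattice.Carrier A} x y →
               All (Sat A ρ) (system x y) → ∀ n → Sat A (ρ ∘ y) (bound n)
system⇒bound A {ρ = ρ} x y (e≤x ∷ x≤tx ∷ []) n =
  LatticeOrder.trans A e≤x (fixpoint-below-iter A (ρ ∘ y) x≤tx n)

-- Solving the system in an extension

record SolvableExtension (A : Lattice 0ℓ 0ℓ) (ρ : Fin 5 → Lattice.Carrier A) : Set₁ where
  field
    lattice : Lattice 0ℓ 0ℓ
    embed : Lattice.Carrier A → Lattice.Carrier lattice
    mono : IsLatticeMonomorphism (Lattice.rawLattice A) (Lattice.rawLattice lattice) embed
    solution : Lattice.Carrier lattice

  valuation : Fin 6 → Lattice.Carrier lattice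
  valuation = solution Vector.∷ (embed ∘ ρ)

  field
    lower-holds : Sat lattice valuation (lower zero suc)
    upper-holds : Sat lattice valuation (upper zero suc)

  reflect : ∀ ε → Sat lattice (embed ∘ ρ) ε → Sat A ρ ε
  reflect = satisfies-reflect (toStructure lattice solution) mono

-- Decreasing sequences s stand for the filters they generate, in reverse inclusion;
-- in this completion every lattice operation preserves the infimum of a decreasing sequence.
module Filters (A : Lattice 0ℓ 0ℓ) where
  open LatticeOrder A renaming (refl to ≤-refl; trans to ≤-trans; _≤_ to _⊑_)

  Decreasing : Set
  Decreasing = Σ[ s ∈ (ℕ → Carrier) ] (∀ n → s (suc n) ⊑ s n)

  infix 4 _≲_
  _≲_ : Rel Decreasing 0ℓ
  (s , _) ≲ (s′ , _) = ∀ m → ∃[ n ] s n ⊑ s′ m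

  antitone : ((s , _) : Decreasing) → ∀ {m n} → m ℕ.≤′ n → s n ⊑ s m
  antitone s ℕ.≤′-refl = ≤-refl
  antitone s (ℕ.≤′-step m≤n) = ≤-trans (proj₂ s _) (antitone s m≤n)

  ≲-refl : ∀ s → s ≲ s
  ≲-refl s m = m , ≤-refl

  ≲-trans : ∀ s t u → s ≲ t → t ≲ u → s ≲ u
  ≲-trans s t u p q m = let n , sn≤ = q m ; k , sk≤ = p n in k , ≤-trans sk≤ sn≤

  -- In reverse inclusion joins are intersections of filters, generated by the termwise joins, and
  -- meets are the filters generated by unions.
  join′ meet′ : Decreasing → Decreasing → Decreasing
  join′ (s , ds) (s′ , ds′) = (λ n → s n ∨ s′ n) , λ n → ∨-monotonic (ds n) (ds′ n)
  meet′ (s , ds) (s′ , ds′) = (λ n → s n ∧ s′ n) , λ n → ∧-monotonic (ds n) (ds′ n)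

  supremum′ : Supremum _≲_ join′
  supremum′ s s′ = (λ m → m , x≤x∨y _ _) , (λ m → m , y≤x∨y _ _) ,
    λ u p q m → let i , si≤ = p m ; j , sj≤ = q m in
      i ℕ.⊔ j , ∨-least (≤-trans (antitone s (ℕ.≤⇒≤′ (ℕ.m≤m⊔n i j))) si≤)
                        (≤-trans (antitone s′ (ℕ.≤⇒≤′ (ℕ.m≤n⊔m i j))) sj≤)

  infimum′ : Infimum _≲_ meet′
  infimum′ s s′ = (λ m → m , x∧y≤x _ _) , (λ m → m , x∧y≤y _ _) ,
    λ u p q m → let i , ui≤ = p m ; j , uj≤ = q m in
      i ℕ.⊔ j , ∧-greatest (≤-trans (antitone u (ℕ.≤⇒≤′ (ℕ.m≤m⊔n i j))) ui≤)
                           (≤-trans (antitone u (ℕ.≤⇒≤′ (ℕ.m≤n⊔m i j))) uj≤)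

  open FromPreorder {Decreasing} {_≲_} {join′} {meet′} ≲-refl ≲-trans supremum′ infimum′ public

  constant : Carrier → Decreasing
  constant a = (λ _ → a) , λ _ → ≤-refl

  constant-mono : IsLatticeMonomorphism (Lattice.rawLattice A) (Lattice.rawLattice lattice) constant
  constant-mono = record
    { isLatticeHomomorphism = record
      { isRelHomomorphism = record
        { cong = λ a≈b → (λ m → m , reflexive a≈b) , (λ m → m , reflexive (Eq.sym a≈b)) }
      ; ∧-homo = λ _ _ → (λ m → m , ≤-refl) , (λ m → m , ≤-refl)
      ; ∨-homo = λ _ _ → (λ m → m , ≤-refl) , (λ m → m , ≤-refl)
      }
    ; injective = λ (p , q) → antisym (proj₂ (p 0)) (proj₂ (q 0))
    }

  abstract
    bounded⇒solvable : ∀ ρ → (∀ n → Sat A ρ (bound n)) → SolvableExtension A ρ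
    bounded⇒solvable ρ bounded = record
      { lattice = lattice
      ; embed = constant
      ; mono = constant-mono
      ; solution = solution
      ; lower-holds = ≲⇒≤ {constant (ρ 4F)} {solution} (λ m → 0 , bounded m)
      -- t of the solution is computed termwise: its m-th term is t(tᵐ(d)) = tᵐ⁺¹(d), which is the
      -- term of the solution at `suc m`.
      ; upper-holds = ≲⇒≤ {solution}
          {eval (Lattice.rawLattice lattice) (solution Vector.∷ (constant ∘ ρ)) (step suc (var zero))}
          (λ m → suc m , ≤-refl)
      }
      where
      solution : Decreasing
      solution = (λ n → eval (Lattice.rawLattice A) ρ (iter n)) , iter-decreasing A ρ

-- The relation `_≈_` is arbitrary, so that quotients of free lattices and the union `limit` are
-- covered alike.
eval-term : ∀ {X Y : Set} (_≈_ : Rel (Term Y) 0ℓ) (σ : X → Term Y) s →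
            eval (record { _≈_ = _≈_ ; _∧_ = _⊓_ ; _∨_ = _⊔_ }) σ s ≡ bind σ s
eval-term _≈_ σ (var x) = refl
eval-term _≈_ σ (s ⊓ t) = cong₂ _⊓_ (eval-term _≈_ σ s) (eval-term _≈_ σ t)
eval-term _≈_ σ (s ⊔ t) = cong₂ _⊔_ (eval-term _≈_ σ s) (eval-term _≈_ σ t)

eval-var : ∀ {X : Set} (_≈_ : Rel (Term X) 0ℓ) (s : Term X) →
           eval (record { _≈_ = _≈_ ; _∧_ = _⊓_ ; _∨_ = _⊔_ }) var s ≡ s
eval-var _≈_ s = trans (eval-term _≈_ var s) (bind-var s)

sat-term : ∀ {X Y : Set} (_≈_ : Rel (Term Y) 0ℓ) (σ : X → Term Y) s t →
           Satisfies (record { _≈_ = _≈_ ; _∧_ = _⊓_ ; _∨_ = _⊔_ }) σ (s , t) ⇔ bind σ s ≈ bind σ t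
sat-term _≈_ σ s t rewrite eval-term _≈_ σ s | eval-term _≈_ σ t = mk⇔ id id

sat-var : ∀ {X : Set} (_≈_ : Rel (Term X) 0ℓ) s t →
          Satisfies (record { _≈_ = _≈_ ; _∧_ = _⊓_ ; _∨_ = _⊔_ }) var (s , t) ⇔ s ≈ t
sat-var _≈_ s t rewrite eval-var _≈_ s | eval-var _≈_ t = mk⇔ id id

-- The lattices presented by e ≤ tⁿ(d), and their union over n

stage : ℕ → Lattice 0ℓ 0ℓ
stage n = Quotient (FreeLattice (Fin 5)) (bound n ∷ [])

stage-sat : ∀ n ε → uncurry (Lattice._≈_ (stage n)) ε ⇔ Sat (stage n) var ε
stage-sat n (s , t) = mk⇔ (from (sat-var _≈_ s t)) (to (sat-var _≈_ s t))
  where open Lattice (stage n) using (_≈_)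

stage-bound : ∀ n → Sat (stage n) var (bound n)
stage-bound n = to (stage-sat n (bound n)) (generator (here refl))

stage-universal : ∀ n ε → Sat (stage n) var ε →
                  ∀ A (ρ : Fin 5 → Lattice.Carrier A) → Sat A ρ (bound n) → Sat A ρ ε
stage-universal n ε p A ρ b = Cg-elim A (b ∷ []) {proj₁ ε} {proj₂ ε} (from (stage-sat n ε) p)

-- The generators of `stage n` satisfy the weaker bound m, so `stage n` is a quotient of `stage m`.
stage-mono : ∀ {m n} → m ≤ n → ∀ ε → Sat (stage m) var ε → Sat (stage n) var ε
stage-mono {m} {n} m≤n ε p = stage-universal m ε p (stage n) var
  (bound-antitone (stage n) var (ℕ.≤⇒≤′ m≤n) (stage-bound n))

raise : ∀ {m n} → m ≤ n → ∀ {s t} → Lattice._≈_ (stage m) s t → Lattice._≈_ (stage n) s t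
raise {m} {n} m≤n {s} {t} p =
  from (stage-sat n (s , t)) (stage-mono m≤n (s , t) (to (stage-sat m (s , t)) p))

-- The lattice presented by all the bounds together. `Cg` admits only finitely many relations, so
-- the congruence is built as the union of the increasing congruences of the stages.
limit : Lattice 0ℓ 0ℓ
limit = record
  { Carrier = Term (Fin 5)
  ; _≈_ = λ s t → ∃[ n ] Lattice._≈_ (stage n) s t
  ; _∨_ = _⊔_
  ; _∧_ = _⊓_
  ; isLattice = record
    { isEquivalence = record
      { refl = 0 , Lattice.refl (stage 0)
      ; sym = λ (n , p) → n , Cg-sym p
      ; trans = merge Cg-trans
      }
    ; ∨-comm = λ s t → 0 , Lattice.∨-comm (stage 0) s t
    ; ∨-assoc = λ s t u → 0 , Lattice.∨-assoc (stage 0) s t u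
    ; ∨-cong = merge ∨-compatible
    ; ∧-comm = λ s t → 0 , Lattice.∧-comm (stage 0) s t
    ; ∧-assoc = λ s t u → 0 , Lattice.∧-assoc (stage 0) s t u
    ; ∧-cong = merge ∧-compatible
    ; absorptive = (λ s t → 0 , Lattice.∨-absorbs-∧ (stage 0) s t)
                 , (λ s t → 0 , Lattice.∧-absorbs-∨ (stage 0) s t)
    }
  }
  where
  merge : ∀ {s₁ t₁ s₂ t₂ s₃ t₃ : Term (Fin 5)} →
          (∀ {n} → Lattice._≈_ (stage n) s₁ t₁ → Lattice._≈_ (stage n) s₂ t₂ →
                   Lattice._≈_ (stage n) s₃ t₃) →
          ∃[ m ] Lattice._≈_ (stage m) s₁ t₁ → ∃[ n ] Lattice._≈_ (stage n) s₂ t₂ →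
          ∃[ k ] Lattice._≈_ (stage k) s₃ t₃
  merge f (m , p) (n , q) = m ℕ.⊔ n , f (raise (ℕ.m≤m⊔n m n) p) (raise (ℕ.m≤n⊔m m n) q)

limit-sat : ∀ ε → Sat limit var ε ⇔ (∃[ n ] Sat (stage n) var ε)
limit-sat (s , t) = mk⇔
  (λ p → let n , q = to (sat-var _≈_ s t) p in n , to (stage-sat n (s , t)) q)
  (λ (n , q) → from (sat-var _≈_ s t) (n , from (stage-sat n (s , t)) q))
  where open Lattice limit using (_≈_)

limit-bound : ∀ n → Sat limit var (bound n)
limit-bound n = from (limit-sat (bound n)) (n , stage-bound n)

-- Each equation of the limit holds from some stage on; for a finite list the largest of these
-- stages serves.
eventually-satisfied : ∀ {Π} → All (Sat limit var) Π → ∃[ n ] All (Sat (stage n) var) Π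
eventually-satisfied [] = 0 , []
eventually-satisfied {ε ∷ Π} (p ∷ ps) =
  let m , q = to (limit-sat ε) p
      n , qs = eventually-satisfied ps
  in m ℕ.⊔ n , stage-mono (ℕ.m≤m⊔n m n) ε q ∷ All.map (λ {δ} → stage-mono (ℕ.m≤n⊔m m n) δ) qs

-- A lattice separating e ≤ tᴺ(d) from e ≤ tᴺ⁺¹(d)

-- (A , C , i , j) stands for the set of points p₁,…,pᵢ, q₁,…,qⱼ and, when A and C are large,
-- α and γ; the closure rules are α, qₖ₊₁ ⊢ pₖ and γ, pₖ ⊢ qₖ.  With d the set of all p's,
-- b the set of all q's, a = {α} and c = {γ}, the operation t removes the last point of {p₁,…,pᵢ}.
module Separation where
  Quad : Set
  Quad = ℕ × ℕ × ℕ × ℕ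

  infix 4 _⊑_ _≲_
  _⊑_ _≲_ : Rel Quad 0ℓ
  (A , C , i , j) ⊑ (A′ , C′ , i′ , j′) = A ≤ A′ × C ≤ C′ × i ≤ i′ × j ≤ j′

  -- `A` and `C` act as caps: α yields pₖ from qₖ₊₁ for k ≤ A, and γ yields qₖ from pₖ for k ≤ C.
  -- Both rules are applied once, simultaneously.
  closure : Quad → Quad
  closure (A , C , i , j) = A , C , i ℕ.⊔ (A ℕ.⊓ pred j) , j ℕ.⊔ (C ℕ.⊓ i)

  -- A quad represents its closure; quads with the same closure are equal in the lattice.
  u ≲ v = u ⊑ closure v

  glb lub : Quad → Quad → Quad
  glb (A , C , i , j) (A′ , C′ , i′ , j′) = A ℕ.⊓ A′ , C ℕ.⊓ C′ , i ℕ.⊓ i′ , j ℕ.⊓ j′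
  lub (A , C , i , j) (A′ , C′ , i′ , j′) = A ℕ.⊔ A′ , C ℕ.⊔ C′ , i ℕ.⊔ i′ , j ℕ.⊔ j′

  ⊑-trans : Transitive _⊑_
  ⊑-trans (p , q , r , s) (p′ , q′ , r′ , s′) =
    ℕ.≤-trans p p′ , ℕ.≤-trans q q′ , ℕ.≤-trans r r′ , ℕ.≤-trans s s′

  ⊑-supremum : Supremum _⊑_ lub
  ⊑-supremum _ _ =
    (ℕ.m≤m⊔n _ _ , ℕ.m≤m⊔n _ _ , ℕ.m≤m⊔n _ _ , ℕ.m≤m⊔n _ _) ,
    (ℕ.m≤n⊔m _ _ , ℕ.m≤n⊔m _ _ , ℕ.m≤n⊔m _ _ , ℕ.m≤n⊔m _ _) ,
    λ _ (p , q , r , s) (p′ , q′ , r′ , s′) →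
      ℕ.⊔-lub p p′ , ℕ.⊔-lub q q′ , ℕ.⊔-lub r r′ , ℕ.⊔-lub s s′

  ⊑-infimum : Infimum _⊑_ glb
  ⊑-infimum _ _ =
    (ℕ.m⊓n≤m _ _ , ℕ.m⊓n≤m _ _ , ℕ.m⊓n≤m _ _ , ℕ.m⊓n≤m _ _) ,
    (ℕ.m⊓n≤n _ _ , ℕ.m⊓n≤n _ _ , ℕ.m⊓n≤n _ _ , ℕ.m⊓n≤n _ _) ,
    λ _ (p , q , r , s) (p′ , q′ , r′ , s′) →
      ℕ.⊓-glb p p′ , ℕ.⊓-glb q q′ , ℕ.⊓-glb r r′ , ℕ.⊓-glb s s′

  closure-extensive : ∀ u → u ⊑ closure u
  closure-extensive _ = ℕ.≤-refl , ℕ.≤-refl , ℕ.m≤m⊔n _ _ , ℕ.m≤m⊔n _ _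

  closure-mono : ∀ {u v} → u ⊑ v → closure u ⊑ closure v
  closure-mono (p , q , r , s) =
    p , q , ℕ.⊔-mono-≤ r (ℕ.⊓-mono-≤ p (ℕ.pred-mono-≤ s)) , ℕ.⊔-mono-≤ s (ℕ.⊓-mono-≤ q r)

  -- A second round adds nothing: the q's gained by γ have index at most i, so α only leads back to
  -- p's already present, and the p's gained by α have index below j, so γ only leads back to q's
  -- already present.
  closure-idem : ∀ u → closure (closure u) ⊑ closure u
  closure-idem (A , C , i , j) = ℕ.≤-refl , ℕ.≤-refl
    , ℕ.⊔-lub ℕ.≤-refl (begin
        A ℕ.⊓ pred (j ℕ.⊔ (C ℕ.⊓ i))
          ≤⟨ ℕ.⊓-monoʳ-≤ A (pred-⊔ j (C ℕ.⊓ i)) ⟩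
        A ℕ.⊓ (pred j ℕ.⊔ pred (C ℕ.⊓ i))
          ≡⟨ ℕ.⊓-distribˡ-⊔ A _ _ ⟩
        (A ℕ.⊓ pred j) ℕ.⊔ (A ℕ.⊓ pred (C ℕ.⊓ i))
          ≤⟨ ℕ.⊔-monoʳ-≤ (A ℕ.⊓ pred j) (ℕ.≤-trans (ℕ.m⊓n≤n A _) (ℕ.≤-trans ℕ.pred[n]≤n (ℕ.m⊓n≤n C i))) ⟩
        (A ℕ.⊓ pred j) ℕ.⊔ i
          ≡⟨ ℕ.⊔-comm _ i ⟩
        i ℕ.⊔ (A ℕ.⊓ pred j) ∎)
    , ℕ.⊔-lub ℕ.≤-refl (begin
        C ℕ.⊓ (i ℕ.⊔ (A ℕ.⊓ pred j))
          ≡⟨ ℕ.⊓-distribˡ-⊔ C i _ ⟩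
        (C ℕ.⊓ i) ℕ.⊔ (C ℕ.⊓ (A ℕ.⊓ pred j))
          ≤⟨ ℕ.⊔-monoʳ-≤ (C ℕ.⊓ i) (ℕ.≤-trans (ℕ.m⊓n≤n C _) (ℕ.≤-trans (ℕ.m⊓n≤n A _) ℕ.pred[n]≤n)) ⟩
        (C ℕ.⊓ i) ℕ.⊔ j
          ≡⟨ ℕ.⊔-comm _ j ⟩
        j ℕ.⊔ (C ℕ.⊓ i) ∎)
    where
    open ℕ.≤-Reasoning
    pred-⊔ : ∀ m n → pred (m ℕ.⊔ n) ≤ pred m ℕ.⊔ pred n
    pred-⊔ zero n = ℕ.≤-refl
    pred-⊔ (suc m) zero = ℕ.m≤m⊔n m 0
    pred-⊔ (suc m) (suc n) = ℕ.≤-refl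

  ≲-trans : ∀ u v w → u ≲ v → v ≲ w → u ≲ w
  ≲-trans u v w u≲v v≲w = ⊑-trans u≲v (⊑-trans (closure-mono v≲w) (closure-idem w))

  ≲-supremum : Supremum _≲_ lub
  ≲-supremum u v = let u⊑ , v⊑ , least = ⊑-supremum u v in
    ⊑-trans u⊑ (closure-extensive _) , ⊑-trans v⊑ (closure-extensive _) , λ w → least (closure w)

  -- Meets are intersections of closed sets, so both arguments are closed before `glb`; for joins
  -- the closure built into `≲` does this.
  ≲-infimum : Infimum _≲_ (λ u v → glb (closure u) (closure v))
  ≲-infimum u v = let ⊑u , ⊑v , greatest = ⊑-infimum (closure u) (closure v) in
    ⊑u , ⊑v , λ w p q → ⊑-trans (greatest w p q) (closure-extensive _)

  open FromPreorder {_≲_ = _≲_} closure-extensive ≲-trans ≲-supremum ≲-infimum public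

  module _ (N : ℕ) where
    -- With N + 1 points, the value of tⁿ(d) still contains p₁ exactly when n ≤ N.
    private M = suc N

    valuation : Fin 5 → Quad
    valuation 0F = 0 , 0 , M , 0
    valuation 1F = M , 0 , 0 , 0
    valuation 2F = 0 , 0 , 0 , M
    valuation 3F = 0 , M , 0 , 0
    -- e is {p₁}, the last point to be removed.
    valuation 4F = 0 , 0 , 1 , 0

    ⊓-absorb : ∀ {k} → k ≤ M → M ℕ.⊓ (M ℕ.⊓ k) ≡ k
    ⊓-absorb k≤M = trans (cong (M ℕ.⊓_) (ℕ.m≥n⇒m⊓n≡n k≤M)) (ℕ.m≥n⇒m⊓n≡n k≤M)

    -- In c ∨ x the rule γ produces q₁,...,qₖ; the meet with b keeps only these; α turns them into
    -- p₁,...,pₖ₋₁; the meet with d keeps only those.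
    step-value : ∀ {k} → k ≤ M →
      stepValue lattice valuation (0 , 0 , k , 0) ≡ (0 , 0 , pred k , 0)
    step-value {k} k≤M = cong (λ i → 0 , 0 , i , 0) (trans
      (cong (λ j → M ℕ.⊓ (M ℕ.⊓ pred j)) (⊓-absorb k≤M))
      (⊓-absorb (ℕ.≤-trans ℕ.pred[n]≤n k≤M)))

    iter-value : ∀ n → eval (Lattice.rawLattice lattice) valuation (iter n) ≡ (0 , 0 , M ℕ.∸ n , 0)
    iter-value zero = refl
    iter-value (suc n) = trans (cong (stepValue lattice valuation) (iter-value n))
      (trans (step-value (ℕ.m∸n≤m M n)) (cong (λ i → 0 , 0 , i , 0) (ℕ.pred[m∸n]≡m∸[1+n] M n)))

    bound⇔ : ∀ n → Sat lattice valuation (bound n) ⇔ 1 ≤ M ℕ.∸ n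
    bound⇔ n = mk⇔
      (λ p → let _ , _ , q , _ = ≡-subst (valuation 4F ≲_) (iter-value n) (≤⇒≲ {valuation 4F} p)
             in ≡-subst (1 ≤_) (ℕ.⊔-identityʳ _) q)
      (λ q → ≲⇒≤ {valuation 4F} (≡-subst (valuation 4F ≲_) (sym (iter-value n))
               (z≤n , z≤n , ℕ.≤-trans q (ℕ.m≤m⊔n _ 0) , z≤n)))

-- The separating lattice for N = n satisfies the bound n, where p₁ is the one remaining point, and
-- violates the next bound, where none remains.
stage-strict : ∀ n → ¬ Sat (stage n) var (bound (suc n))
stage-strict n p = ℕ.n≮n 0 (≡-subst (1 ≤_) (ℕ.n∸n≡0 n) (to (bound⇔ n (suc n))
  (stage-universal n (bound (suc n)) p lattice (valuation n)
    (from (bound⇔ n n) (ℕ.≤-reflexive (sym (ℕ.m+n∸n≡m 1 n)))))))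
  where open Separation

-- A finite list of consequences of the bounds already holds at the generators of some `stage n`,
-- where the bound `suc n` fails.
bounds-not-finitely-axiomatizable :
  (Π : List (Equation (Fin 5))) → All (Sat limit var) Π →
  ¬ (∀ A ρ → All (Sat A ρ) Π → ∀ n → Sat A ρ (bound n))
bounds-not-finitely-axiomatizable Π sat entails =
  let n , satₙ = eventually-satisfied sat
  in stage-strict n (entails (stage n) var satₙ (suc n))

sat-rename : ∀ (A : Lattice 0ℓ 0ℓ) {X Y : Set} {ρ : Y → Lattice.Carrier A} (f : X → Y) ε →
             Sat A ρ (renameEq f ε) ⇔ Sat A (ρ ∘ f) ε
sat-rename A f (s , t) = satisfies-bind (Lattice.rawLattice A) (var ∘ f) s t

-- Equations in the parameters that follow from the system hold in this extension, hence by
-- reflection in `limit`: they are consequences of the bounds.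
module Extension = SolvableExtension (Filters.bounded⇒solvable limit var limit-bound)

-- Coherence and uniform interpolation

no-right-uniform-interpolation : ¬ RightUniformDeductiveInterpolation
no-right-uniform-interpolation interpolate = bounds-not-finitely-axiomatizable Π
  -- `Π` entails each of its members, so by interpolation the system entails them too, and they hold
  -- in the extension.
  (All.tabulate λ {δ} δ∈Π → Extension.reflect δ
    (to (flatten Extension.lattice δ)
      (from (interpolant 0 (renameEq inj₁ δ))
        (λ A ρ sat → from (flatten A δ) (to (sat-rename A (inj₂ ∘ inj₁) δ) (All.lookup (All.map⁻ sat) δ∈Π)))
        Extension.lattice [ (λ _ → Extension.solution) , [ Extension.embed ∘ var , (λ ()) ] ]
        (Extension.lower-holds ∷ Extension.upper-holds ∷ []))))
  (λ A ρ sat n → to (flatten A (bound n))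
    (to (interpolant 0 (renameEq inj₁ (bound n)))
      (λ B ρ′ sys → from (flatten B (bound n)) (system⇒bound B (inj₁ zero) (inj₂ ∘ inj₁) sys n))
      -- No equation evaluated here mentions x, so its value `ρ 0F` is an arbitrary choice.
      A [ (λ _ → ρ 0F) , [ ρ , (λ ()) ] ]
      (All.map⁺ (All.map (λ {δ} → from (sat-rename A (inj₂ ∘ inj₁) δ)) sat))))
  where
  Π = proj₁ (interpolate 1 4 (system (inj₁ zero) inj₂))
  interpolant = proj₂ (interpolate 1 4 (system (inj₁ zero) inj₂))

  flatten : ∀ A {ρ : Fin 1 ⊎ (Fin 5 ⊎ Fin 0) → Lattice.Carrier A} ε →
            Sat A ρ (renameEq inj₂ (renameEq inj₁ ε)) ⇔ Sat A (ρ ∘ inj₂ ∘ inj₁) ε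
  flatten A ε = ⇔.trans (sat-rename A inj₂ (renameEq inj₁ ε)) (sat-rename A inj₁ ε)

quotient-hom : ∀ {X : Set} {R : List (Equation X)} (A : Lattice 0ℓ 0ℓ) {ρ : X → Lattice.Carrier A} →
               All (Sat A ρ) R →
               IsLatticeHomomorphism (Lattice.rawLattice (Quotient (FreeLattice X) R))
                                     (Lattice.rawLattice A) (eval (Lattice.rawLattice A) ρ)
quotient-hom A sat = record
  { isRelHomomorphism = record { cong = Cg-elim A sat }
  ; ∧-homo = λ _ _ → Lattice.refl A
  ; ∨-homo = λ _ _ → Lattice.refl A
  }

-- Finite presentability does not depend on the choice of the finite generating set.
present-on : ∀ (B : Lattice 0ℓ 0ℓ) → FinitelyPresented B →
             ∀ {k} (g : Fin k → Lattice.Carrier B) →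
             (∀ b → ∃[ s ] Lattice._≈_ B (eval (Lattice.rawLattice B) g s) b) →
             ∃[ Π ] All (Sat B g) Π ×
               (∀ ε → Sat B g ε → ∀ A ρ → All (Sat A ρ) Π → Sat A ρ ε)
present-on B (n , R , f , iso) {k} g express = Π , Π-holds , Π-entails
  where
  module B = Lattice B
  module f = IsLatticeIsomorphism iso
  Q = Quotient (FreeLattice (Fin (suc n))) R
  module Q = Lattice Q

  h : Fin (suc n) → B.Carrier
  h j = proj₁ (f.surjective (var j))

  σ : Fin (suc n) → Term (Fin k)
  σ j = proj₁ (express (h j))

  σ-value : ∀ j → eval B.rawLattice g (σ j) B.≈ h j
  σ-value j = proj₂ (express (h j))

  f∘h : ∀ j → f (h j) Q.≈ var j
  f∘h j = proj₂ (f.surjective (var j)) B.refl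

  Q⇒B : ∀ s t → s Q.≈ t → Sat B g (bind σ s , bind σ t)
  Q⇒B s t p = from (satisfies-bind B.rawLattice σ s t)
    (sat-cong B (λ j → B.sym (σ-value j)) (s , t)
      (satisfies-reflect (toStructure Q s) f.isLatticeMonomorphism (s , t)
        (sat-cong Q (λ j → Q.sym (f∘h j)) (s , t) (from (sat-var Q._≈_ s t) p))))

  g-value : ∀ i → g i B.≈ eval B.rawLattice g (bind σ (f (g i)))
  g-value i rewrite eval-bind B.rawLattice {ρ = g} σ (f (g i)) = B.trans
    (f.injective (Q.trans (Q.trans (Q.reflexive (sym (eval-var Q._≈_ u)))
                                   (Q.sym (eval-cong QS f∘h u)))
                          (eval-homo QS f.isLatticeHomomorphism u)))
    (eval-cong (toStructure B (g i)) (λ j → B.sym (σ-value j)) u)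
    where
    u = f (g i)
    QS = toStructure Q u

  -- Tietze transformations: the relations `R` are rewritten in terms of `g`, and each `g i` is
  -- equated with its own expression through the old generators.
  relations definitions Π : List (Equation (Fin k))
  relations = map (λ (s , t) → bind σ s , bind σ t) R
  definitions = List.tabulate (λ i → var i , bind σ (f (g i)))
  Π = relations ++ definitions

  Π-holds : All (Sat B g) Π
  Π-holds = All.++⁺
    (All.map⁺ (All.tabulate λ {(s , t)} st∈R → Q⇒B s t (generator st∈R)))
    (All.tabulate⁺ g-value)

  Π-entails : ∀ ε → Sat B g ε → ∀ A ρ → All (Sat A ρ) Π → Sat A ρ ε
  Π-entails ε p A ρ sat = sat-cong A ρ-value ε
    (satisfies-homo (toStructure A (eval A.rawLattice ρ (proj₁ ε))) (quotient-hom A R-holds) ε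
      (satisfies-homo (toStructure Q (f (eval B.rawLattice g (proj₁ ε)))) f.isLatticeHomomorphism ε p))
    where
    module A = Lattice A
    -- `R` holds in A under `η`, which gives a homomorphism B → Q → A; by the definitions in `Π` it
    -- sends `g i` to `ρ i`.
    η = eval A.rawLattice ρ ∘ σ

    R-holds : All (Sat A η) R
    R-holds = All.map (λ {(s , t)} → to (satisfies-bind A.rawLattice σ s t)) (All.map⁻ (All.++⁻ˡ relations sat))

    ρ-value : ∀ i → eval A.rawLattice η (f (g i)) A.≈ ρ i
    ρ-value i = A.sym (A.trans (All.tabulate⁻ (All.++⁻ʳ relations sat) i)
                               (A.reflexive (eval-bind A.rawLattice σ (f (g i)))))

generated-term : ∀ (A : Lattice 0ℓ 0ℓ) {k} {g : Fin k → Lattice.Carrier A} {a} →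
                 Generated A g a → ∃[ s ] Lattice._≈_ A (eval (Lattice.rawLattice A) g s) a
generated-term A (generator i) = var i , Lattice.refl A
generated-term A (meet p q) =
  let s , s≈ = generated-term A p ; t , t≈ = generated-term A q
  in s ⊓ t , Lattice.∧-cong A s≈ t≈
generated-term A (join p q) =
  let s , s≈ = generated-term A p ; t , t≈ = generated-term A q
  in s ⊔ t , Lattice.∨-cong A s≈ t≈
generated-term A (respects a≈b p) =
  let s , s≈ = generated-term A p in s , Lattice.trans A s≈ a≈b

subalgebra-mono : ∀ (A : Lattice 0ℓ 0ℓ) {k} (g : Fin k → Lattice.Carrier A) →
                  IsLatticeMonomorphism (Lattice.rawLattice (Subalgebra A g))
                                        (Lattice.rawLattice A) proj₁
subalgebra-mono A g = record
  { isLatticeHomomorphism = record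
    { isRelHomomorphism = record { cong = id }
    ; ∧-homo = λ _ _ → Lattice.refl A
    ; ∨-homo = λ _ _ → Lattice.refl A
    }
  ; injective = id
  }

not-coherent : ¬ Coherent
not-coherent coherent = bounds-not-finitely-axiomatizable Π
  -- Equations among the parameters pass from B to A and, as A is presented by the system, on to the
  -- extension of `limit`.
  (All.map (λ {δ} p → Extension.reflect δ
    (satisfies-homo (toStructure Extension.lattice Extension.solution)
      (quotient-hom Extension.lattice {Extension.valuation} (Extension.lower-holds ∷ Extension.upper-holds ∷ [])) δ
      (satisfies-homo S (IsLatticeMonomorphism.isLatticeHomomorphism B↪A) δ p))) Π-holds)
  -- The generator x of A solves the system, so the bounds hold in A and in its subalgebra B, and
  -- therefore follow from `Π`.
  (λ C ρ sat n → Π-entails (bound n)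
    (satisfies-reflect S B↪A (bound n)
      (system⇒bound A {ρ = var} zero suc (generator (here refl) ∷ generator (there (here refl)) ∷ []) n))
    C ρ sat)
  where
  A = Quotient (FreeLattice (Fin 6)) (system zero suc)
  S = toStructure A (var zero)
  B = Subalgebra A (var ∘ suc)
  B↪A = subalgebra-mono A (var ∘ suc)

  A-presented : FinitelyPresented A
  A-presented = 5 , system zero suc , id ,
    Identity.isLatticeIsomorphism (Lattice.rawLattice A) (Lattice.refl A)

  g : Fin 5 → Lattice.Carrier B
  g i = var (suc i) , generator i

  express : ∀ b → ∃[ s ] Lattice._≈_ B (eval (Lattice.rawLattice B) g s) b
  express (a , p) =
    let s , s≈a = generated-term A p
    in s , Lattice.trans A (Lattice.sym A (eval-homo S (IsLatticeMonomorphism.isLatticeHomomorphism B↪A) s)) s≈a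

  presentation = present-on B (coherent A A-presented (var ∘ suc)) g express
  Π = proj₁ presentation
  Π-holds = proj₁ (proj₂ presentation)
  Π-entails = proj₂ (proj₂ presentation)

-- First-order logic

¬¬-cong-⇔ : {P Q : Set} → P ⇔ Q → (¬ ¬ P) ⇔ (¬ ¬ Q)
¬¬-cong-⇔ = ¬-cong-⇔ ∘ ¬-cong-⇔

Π-cong-⇔ : {A : Set} {P Q : A → Set} → (∀ a → P a ⇔ Q a) → (∀ a → P a) ⇔ (∀ a → Q a)
Π-cong-⇔ P⇔Q = mk⇔ (λ p a → to (P⇔Q a) (p a)) (λ q a → from (P⇔Q a) (q a))

module _ (N : Structure) where
  open Structure N using (Carrier; _≈_; rawLattice)
  private
    module N = Structure N
    module ≈ = IsEquivalence N.isEquivalence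

  module _ {C : Set} {c : C → Carrier} where

    -- Atoms are doubly negated by definition, and implication and universal quantification preserve
    -- stability. This justifies `by-contradiction`.
    truth-stable : ∀ {n} {ρ : Fin n → Carrier} φ → ¬ ¬ truth N c ρ φ → truth N c ρ φ
    truth-stable falsum ¬¬⊥ = ¬¬⊥ id
    truth-stable (s ≐ t) = negated-stable
    truth-stable (φ ⇒ ψ) ¬¬f x = truth-stable ψ (¬¬-map (λ f → f x) ¬¬f)
    truth-stable (all φ) ¬¬f a = truth-stable φ (¬¬-map (λ f → f a) ¬¬f)

    truth-subst : ∀ {m n} {ρ : Fin m → Carrier} {ρ′ : Fin n → Carrier} (σ : Subst C n m) φ →
                  (∀ i → eval rawLattice [ c , ρ ] (σ i) ≈ ρ′ i) →
                  truth N c ρ (subst σ φ) ⇔ truth N c ρ′ φ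
    truth-subst σ falsum σ≈ρ′ = ⇔.refl
    truth-subst {ρ = ρ} {ρ′} σ (s ≐ t) σ≈ρ′ = ¬¬-cong-⇔ (⇔.trans
      (satisfies-bind rawLattice [ var ∘ inj₁ , σ ] s t)
      (satisfies-cong N (λ { (inj₁ x) → ≈.refl ; (inj₂ i) → σ≈ρ′ i }) (s , t)))
    truth-subst σ (φ ⇒ ψ) σ≈ρ′ = →-cong-⇔ (truth-subst σ φ σ≈ρ′) (truth-subst σ ψ σ≈ρ′)
    truth-subst {ρ = ρ} {ρ′} σ (all φ) σ≈ρ′ = Π-cong-⇔ λ a →
      truth-subst (lift σ) φ λ
        { zero → ≈.refl
        ; (suc i) → ≈.trans
            (≈.reflexive (eval-bind rawLattice (var ∘ Sum.map₂ suc) (σ i)))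
            (≈.trans (eval-cong N (λ { (inj₁ x) → ≈.refl ; (inj₂ j) → ≈.refl }) (σ i)) (σ≈ρ′ i))
        }

    -- Allowing any `a` equal to the value of `t` lets `≐-subst` pass from one term to the other
    -- through a common value.
    truth-instance : ∀ {n} {ρ : Fin n → Carrier} {a} φ t → eval rawLattice [ c , ρ ] t ≈ a →
                     truth N c ρ (φ [ t ]) ⇔ truth N c (a Vector.∷ ρ) φ
    truth-instance φ t t≈a = truth-subst _ φ λ { zero → t≈a ; (suc i) → ≈.refl }

    truth-weaken : ∀ {n} {ρ : Fin n → Carrier} {a} φ →
                   truth N c (a Vector.∷ ρ) (weaken φ) ⇔ truth N c ρ φ
    truth-weaken φ = truth-subst _ φ λ i → ≈.refl

  truth-mapConst : ∀ {C D : Set} {n} {c : D → Carrier} {c′ : C → Carrier} {ρ ρ′ : Fin n → Carrier}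
                   (f : C → D) φ → (∀ x → c (f x) ≈ c′ x) → (∀ i → ρ i ≈ ρ′ i) →
                   truth N c ρ (mapConst f φ) ⇔ truth N c′ ρ′ φ
  truth-mapConst f falsum c≈c′ ρ≈ρ′ = ⇔.refl
  truth-mapConst f (s ≐ t) c≈c′ ρ≈ρ′ = ¬¬-cong-⇔ (⇔.trans
    (satisfies-bind rawLattice (var ∘ Sum.map₁ f) s t)
    (satisfies-cong N (λ { (inj₁ x) → c≈c′ x ; (inj₂ i) → ρ≈ρ′ i }) (s , t)))
  truth-mapConst f (φ ⇒ ψ) c≈c′ ρ≈ρ′ =
    →-cong-⇔ (truth-mapConst f φ c≈c′ ρ≈ρ′) (truth-mapConst f ψ c≈c′ ρ≈ρ′)
  truth-mapConst f (all φ) c≈c′ ρ≈ρ′ = Π-cong-⇔ λ a →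
    truth-mapConst f φ c≈c′ λ { zero → ≈.refl ; (suc i) → ρ≈ρ′ i }

  -- Truth of equations is doubly negated, so the lattice laws hold in N only for ¬¬-equality.
  stableLattice : N ⊨ₜ LatticeTheory → Lattice 0ℓ 0ℓ
  stableLattice N⊨ = record
    { _≈_ = λ a b → ¬ ¬ (a ≈ b)
    ; _∨_ = N._∨_
    ; _∧_ = N._∧_
    ; isLattice = record
      { isEquivalence = record
        { refl = λ k → k ≈.refl
        ; sym = ¬¬-map ≈.sym
        ; trans = ¬¬-map₂ ≈.trans
        }
      ; ∨-comm = N⊨ {all (all ((y ⊔ x) ≐ (x ⊔ y)))} λ A _ a b k → k (Lattice.∨-comm A a b)
      ; ∨-assoc = N⊨ {all (all (all (((z ⊔ y) ⊔ x) ≐ (z ⊔ (y ⊔ x)))))}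
          λ A _ a b c k → k (Lattice.∨-assoc A a b c)
      ; ∨-cong = ¬¬-map₂ N.∨-cong
      ; ∧-comm = N⊨ {all (all ((y ⊓ x) ≐ (x ⊓ y)))} λ A _ a b k → k (Lattice.∧-comm A a b)
      ; ∧-assoc = N⊨ {all (all (all (((z ⊓ y) ⊓ x) ≐ (z ⊓ (y ⊓ x)))))}
          λ A _ a b c k → k (Lattice.∧-assoc A a b c)
      ; ∧-cong = ¬¬-map₂ N.∧-cong
      ; absorptive =
          N⊨ {all (all ((y ⊔ y ⊓ x) ≐ y))} (λ A _ a b k → k (Lattice.∨-absorbs-∧ A a b)) ,
          N⊨ {all (all ((y ⊓ (y ⊔ x)) ≐ y))} (λ A _ a b k → k (Lattice.∧-absorbs-∨ A a b))
      }
    }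
    where
    ¬¬-map₂ : {P Q R : Set} → (P → Q → R) → ¬ ¬ P → ¬ ¬ Q → ¬ ¬ R
    ¬¬-map₂ f ¬¬p ¬¬q ¬r = ¬¬p λ p → ¬¬q λ q → ¬r (f p q)

    x y : ∀ {n} → Term (⊥ ⊎ Fin (2 ℕ.+ n))
    x = var (inj₂ 0F)
    y = var (inj₂ 1F)
    z : Term (⊥ ⊎ Fin 3)
    z = var (inj₂ 2F)

  stableLattice-sat : (N⊨ : N ⊨ₜ LatticeTheory) → ∀ {X : Set} {ρ : X → Carrier} ε →
                      Sat (stableLattice N⊨) ρ ε → ¬ ¬ Satisfies rawLattice ρ ε
  stableLattice-sat N⊨ {ρ = ρ} (s , t) eq = L.trans (L.sym (value s)) (L.trans eq (value t))
    where
    module L = Lattice (stableLattice N⊨)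
    value : ∀ u → eval L.rawLattice ρ u L.≈ eval rawLattice ρ u
    value u = eval-homo {A = rawLattice} (toStructure (stableLattice N⊨) N.point) record
      { isRelHomomorphism = record { cong = λ a≈b k → k a≈b }
      ; ∧-homo = λ _ _ k → k ≈.refl
      ; ∨-homo = λ _ _ k → k ≈.refl
      } u

-- Soundness with compactness: Θ collects the axioms from Q that the derivation uses.
module _ {C : Set} {ℓ₁ ℓ₂ : Level} {P : Pred (SentenceOver C) ℓ₁} {Q : Pred (SentenceOver C) ℓ₂} where

  -- `ρ₀` is an arbitrary valuation of no variables, since functions out of `Fin 0` are not
  -- identified without extensionality.
  Consequence : List (SentenceOver C) → ∀ {n} → List (Formula C n) → Formula C n → Set (lsuc 0ℓ Level.⊔ ℓ₁)
  Consequence Θ Δ φ = ∀ (N : Structure) (c : C → Structure.Carrier N) (ρ₀ : Fin 0 → Structure.Carrier N) →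
    (∀ {ψ} → P ψ → truth N c ρ₀ ψ) → All (truth N c ρ₀) Θ →
    ∀ ρ → All (truth N c ρ) Δ → truth N c ρ φ

  sound : ∀ {n} {Δ : List (Formula C n)} {φ} → Derivation (P ∪ Q) Δ φ →
          ∃[ Θ ] All Q Θ × Consequence Θ Δ φ
  sound (axiom {φ = φ} (inj₁ p)) =
    [] , [] , λ N c ρ₀ ⊨P _ ρ _ → from (truth-subst N _ φ λ ()) (⊨P p)
  sound (axiom {φ = φ} (inj₂ q)) =
    φ ∷ [] , q ∷ [] , λ { N c ρ₀ _ (⊨φ ∷ []) ρ _ → from (truth-subst N _ φ λ ()) ⊨φ }
  sound (hypothesis φ∈Δ) = [] , [] , λ N c ρ₀ _ _ ρ ⊨Δ → All.lookup ⊨Δ φ∈Δ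
  sound (⇒-intro d) =
    let Θ , q , ih = sound d in Θ , q , λ N c ρ₀ ⊨P ⊨Θ ρ ⊨Δ ⊨φ → ih N c ρ₀ ⊨P ⊨Θ ρ (⊨φ ∷ ⊨Δ)
  sound (⇒-elim d₁ d₂) =
    let Θ₁ , q₁ , ih₁ = sound d₁
        Θ₂ , q₂ , ih₂ = sound d₂
    in Θ₁ ++ Θ₂ , All.++⁺ q₁ q₂ , λ N c ρ₀ ⊨P ⊨Θ ρ ⊨Δ →
         ih₁ N c ρ₀ ⊨P (All.++⁻ˡ Θ₁ ⊨Θ) ρ ⊨Δ (ih₂ N c ρ₀ ⊨P (All.++⁻ʳ Θ₁ ⊨Θ) ρ ⊨Δ)
  sound (by-contradiction {φ = φ} d) =
    let Θ , q , ih = sound d in Θ , q , λ N c ρ₀ ⊨P ⊨Θ ρ ⊨Δ →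
      truth-stable N φ λ ⊭φ → ih N c ρ₀ ⊨P ⊨Θ ρ (⊭φ ∷ ⊨Δ)
  sound (all-intro d) =
    let Θ , q , ih = sound d in Θ , q , λ N c ρ₀ ⊨P ⊨Θ ρ ⊨Δ a →
      ih N c ρ₀ ⊨P ⊨Θ (a Vector.∷ ρ) (All.map⁺ (All.map (λ {ψ} → from (truth-weaken N ψ)) ⊨Δ))
  sound (all-elim {φ = φ} d t) =
    let Θ , q , ih = sound d in Θ , q , λ N c ρ₀ ⊨P ⊨Θ ρ ⊨Δ →
      from (truth-instance N φ t (IsEquivalence.refl (Structure.isEquivalence N))) (ih N c ρ₀ ⊨P ⊨Θ ρ ⊨Δ _)
  sound (≐-refl t) = [] , [] , λ N c ρ₀ _ _ ρ _ k → k (IsEquivalence.refl (Structure.isEquivalence N))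
  sound (≐-subst {s = s} {t} φ d₁ d₂) =
    let Θ₁ , q₁ , ih₁ = sound d₁
        Θ₂ , q₂ , ih₂ = sound d₂
    -- The equality of `s` and `t` is known only up to double negation, which the stability of
    -- `φ [ t ]` removes.
    in Θ₁ ++ Θ₂ , All.++⁺ q₁ q₂ , λ N c ρ₀ ⊨P ⊨Θ ρ ⊨Δ → truth-stable N (φ [ t ])
         (¬¬-map (λ s≈t → from (truth-instance N φ t (IsEquivalence.refl (Structure.isEquivalence N)))
                            (to (truth-instance N φ s s≈t) (ih₂ N c ρ₀ ⊨P (All.++⁻ʳ Θ₁ ⊨Θ) ρ ⊨Δ)))
                 (ih₁ N c ρ₀ ⊨P (All.++⁻ˡ Θ₁ ⊨Θ) ρ ⊨Δ))

-- Diagrams and model completions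

module _ {M N : Structure} {h : Structure.Carrier M → Structure.Carrier N}
         (mono : IsLatticeMonomorphism (Structure.rawLattice M) (Structure.rawLattice N) h) where
  open Structure N using (_≈_)

  embedding-truth : ∀ {C : Set} {n} {c : C → Structure.Carrier M} {ρ : Fin n → Structure.Carrier M} {ρ′} →
                    (∀ i → h (ρ i) ≈ ρ′ i) → ∀ {φ} → QuantifierFree φ →
                    truth M c ρ φ ⇔ truth N (h ∘ c) ρ′ φ
  embedding-truth h∘ρ≈ρ′ falsum = ⇔.refl
  embedding-truth {c = c} {ρ} {ρ′} h∘ρ≈ρ′ (s ≐ t) = ¬¬-cong-⇔ (⇔.trans
    (mk⇔ (satisfies-homo N (IsLatticeMonomorphism.isLatticeHomomorphism mono) (s , t))
         (satisfies-reflect N mono (s , t)))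
    (satisfies-cong N (λ { (inj₁ x) → IsEquivalence.refl (Structure.isEquivalence N)
                           ; (inj₂ i) → h∘ρ≈ρ′ i }) (s , t)))
  embedding-truth h∘ρ≈ρ′ (φ ⇒ ψ) = →-cong-⇔ (embedding-truth h∘ρ≈ρ′ φ) (embedding-truth h∘ρ≈ρ′ ψ)

limitStructure : Structure
limitStructure = toStructure limit (var 0F)

stageStructure : ℕ → Structure
stageStructure n = toStructure (stage n) (var 0F)

-- Equations persist once true, so a quantifier-free formula has a constant truth value from some
-- stage on. Finding that stage takes a case distinction on whether an equation ever becomes true,
-- hence the double negation.
eventually-agrees : ∀ {φ : SentenceOver (Term (Fin 5))} → QuantifierFree φ → ∀ ρ →
  ¬ ¬ (∃[ n ] ∀ {m} → n ≤ m → truth (stageStructure m) id ρ φ ⇔ truth limitStructure id ρ φ)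
eventually-agrees falsum ρ k = k (0 , λ _ → ⇔.refl)
-- Stage 0 serves if the equation never holds; should it hold in the limit, the stage witnessing
-- this is offered to `k` instead.
eventually-agrees (s ≐ t) ρ k = k (0 , λ {m} _ → mk⇔
    (¬¬-map (λ p → from limit-term (m , to (stage-term m) p)))
    (λ ¬¬p → ⊥-elim (¬¬p λ p → let n , q = to limit-term p in
      k (n , λ {m} n≤m → mk⇔ (λ _ → contradiction p)
                             (λ _ → contradiction (from (stage-term m) (raise n≤m q)))))))
  where
  τ = [ id , ρ ]
  limit-term : Sat limit τ (s , t) ⇔ Lattice._≈_ limit (bind τ s) (bind τ t)
  limit-term = sat-term (Lattice._≈_ limit) τ s t
  stage-term : ∀ n → Sat (stage n) τ (s , t) ⇔ Lattice._≈_ (stage n) (bind τ s) (bind τ t)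
  stage-term n = sat-term (Lattice._≈_ (stage n)) τ s t
eventually-agrees (φ ⇒ ψ) ρ k =
  eventually-agrees φ ρ λ (m , agree₁) → eventually-agrees ψ ρ λ (n , agree₂) →
    k (m ℕ.⊔ n , λ ≤k → →-cong-⇔ (agree₁ (ℕ.≤-trans (ℕ.m≤m⊔n m n) ≤k))
                                 (agree₂ (ℕ.≤-trans (ℕ.m≤n⊔m m n) ≤k)))

Diagram-truth : ∀ {M N : Structure} {h} →
  IsLatticeMonomorphism (Structure.rawLattice M) (Structure.rawLattice N) h →
  ∀ {φ} → Diagram M φ → ∀ ρ₀ → truth N h ρ₀ φ
Diagram-truth {N = N} mono (qf , ⊨φ) ρ₀ = to (embedding-truth {N = N} mono (λ ()) qf) ⊨φ

eventually-in-diagram : ∀ {Θ} → All (Diagram limitStructure) Θ →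
  ¬ ¬ (∃[ n ] ∀ {m} → n ≤ m → All (Diagram (stageStructure m)) Θ)
eventually-in-diagram [] k = k (0 , λ _ → [])
eventually-in-diagram ((qf , ⊨φ) ∷ ds) k =
  eventually-agrees qf _ λ (m , agree) → eventually-in-diagram ds λ (n , rest) →
    k (m ℕ.⊔ n , λ ≤k → (qf , from (agree (ℕ.≤-trans (ℕ.m≤m⊔n m n) ≤k)) ⊨φ)
                      ∷ rest (ℕ.≤-trans (ℕ.m≤n⊔m m n) ≤k))

equality : ∀ {C : Set} {n} → Equation (C ⊎ Fin n) → Formula C n
equality (s , t) = s ≐ t

-- The sentence ∃x (e ≤ x ≤ t(x)) in classical encoding, with the parameters as constants naming the
-- generators of `limit`.
solvable : SentenceOver (Term (Fin 5))
solvable = neg (all (equality (lower x y) ⇒ neg (equality (upper x y))))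
  where
  x = inj₂ 0F
  y = inj₁ ∘ var

module _ (N : Structure) (c : Term (Fin 5) → Structure.Carrier N) (ρ₀ : Fin 0 → Structure.Carrier N) where
  open Structure N

  solution⇒solvable : ∀ a →
    Satisfies rawLattice (a Vector.∷ (c ∘ var)) (lower zero suc) →
    Satisfies rawLattice (a Vector.∷ (c ∘ var)) (upper zero suc) →
    truth N c ρ₀ solvable
  solution⇒solvable a lo up none = none a (λ k → k lo) (λ k → k up)

  -- N obeys the lattice laws only up to double negation, so the bound is derived in `stableLattice`
  -- and carried back.
  solvable⇒bounds : N ⊨ₜ LatticeTheory → truth N c ρ₀ solvable →
                    ∀ n → ¬ ¬ Satisfies rawLattice (c ∘ var) (bound n)
  solvable⇒bounds N⊨ solved n unbounded = solved λ a lo up →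
    stableLattice-sat N N⊨ (bound n)
      (system⇒bound (stableLattice N N⊨) {ρ = a Vector.∷ (c ∘ var)} zero suc (lo ∷ up ∷ []) n)
      unbounded

no-model-completion : ¬ HasModelCompletion LatticeTheory
no-model-completion (T* , completion) =
  proj₂ (complete limitStructure (λ p → p limit _)) solvable λ
    -- The proof uses finitely many diagram sentences, which are true in some `stage n`. In a model
    -- of `T*` extending that stage the system is then solvable, so the bound `suc n` would hold and
    -- be reflected to the stage.
    { (inj₁ ⊢solvable) →
        let Θ , ds , consequence = sound ⊢solvable
        in eventually-in-diagram ds λ (n , agree) →
          let N , N⊨T* , h , mono = embeds (stageStructure n) (λ p → p (stage n) _)
              ⊨solvable = consequence N h (λ ()) (T*-holds N N⊨T*)
                (All.map (λ d → Diagram-truth {N = N} mono d _) (agree ℕ.≤-refl)) (λ ()) []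
          in solvable⇒bounds N h (λ ()) (λ p → N⊨T* (extends p)) ⊨solvable (suc n)
               (λ b → stage-strict n (satisfies-reflect N mono (bound (suc n)) b))
    -- The extension of `limit` containing a solution embeds into a model of `T*`, where both the
    -- diagram of `limit` and `solvable` are true.
    ; (inj₂ ⊢unsolvable) →
        let Θ , ds , consequence = sound ⊢unsolvable
            N , N⊨T* , h , mono = embeds (toStructure Extension.lattice Extension.solution)
                                         (λ p → p Extension.lattice _)
            hom = IsLatticeMonomorphism.isLatticeHomomorphism mono
            embedding = isLatticeMonomorphism (IsEquivalence.trans (Structure.isEquivalence N))
                          Extension.mono mono
        in consequence N (h ∘ Extension.embed) (λ ()) (T*-holds N N⊨T*)
             (All.map (λ d → Diagram-truth {N = N} embedding d _) ds) (λ ()) []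
             (solution⇒solvable N (h ∘ Extension.embed) (λ ()) (h Extension.solution)
               (satisfies-homo N hom {ρ = Extension.valuation} (lower zero suc) Extension.lower-holds)
               (satisfies-homo N hom {ρ = Extension.valuation} (upper zero suc) Extension.upper-holds))
    }
  where
  open IsModelCompletion completion

  -- Sentences of `T*` contain no constants, so their truth is independent of `c` and `ρ₀`.
  T*-holds : ∀ N → N ⊨ₜ T* → ∀ {C : Set} {c : C → Structure.Carrier N} {ρ₀ ψ} →
             withConstants C T* ψ → truth N c ρ₀ ψ
  T*-holds N N⊨T* {c = c} {ρ₀} (χ , p , eq) = ≡-subst (truth N c ρ₀) (sym eq)
    (from (truth-mapConst N _ χ (λ ()) (λ ())) (N⊨T* p))

corollary5p14 : ¬ Coherent × ¬ RightUniformDeductiveInterpolation × ¬ HasModelCompletion LatticeTheory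
corollary5p14 = not-coherent , no-right-uniform-interpolation , no-model-completion
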